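{- Each of the logics $\mathbf{K4}_h$, $\mathbf{KD4}_h$, $\mathbf{S4}_h$ and $\mathbf{GL}_h$ has the strong disjunction property: for $L$ any of these logics and any formulas $\Box_nA$, $\Box_mB$ of $\mathcal{L}_\infty$, if $L\vdash\Box_nA\vee\Box_mB$ then $L\vdash A$ or $L\vdash B$.
   Context: The language $\mathcal{L}_\infty$ consists of modal formulas built from propositional atoms, $\bot,\top$, the connectives $\neg,\wedge,\vee,\rightarrow$ and unary modalities $\Box_n$ ($n\in\mathbb{N}$), with the restriction that $\Box_n A$ is a formula only if $n$ is strictly greater than the index of every box occurring in $A$. Axiom instances are only those that are $\mathcal{L}_\infty$-formulas. Axiom schemes (for all $n\ge0$): $\mathbf{H}$: $\Box_n A\rightarrow\Box_{n+1}A$; $\mathbf{K}_h$: $\Box_n(A\rightarrow B)\rightarrow(\Box_nA\rightarrow\Box_nB)$; $\mathbf{4}_h$: $\Box_nA\rightarrow\Box_{n+1}\Box_nA$; $\mathbf{D}_h$: $\neg\Box_n\bot$; $\mathbf{L}_h$: $\Box_{n+1}(\Box_nA\rightarrow A)\rightarrow\Box_nA$; $\mathbf{T}_h$: $\Box_nA\rightarrow A$. For a set $X$ of schemes, $L(X)$ is the least set of $\mathcal{L}_\infty$-formulas containing all classical propositional tautologies and all instances of the schemes in $X$, closed under modus ponens and the rule: from $A$ infer $\Box_nA$ for any $n$ greater than all box indices in $A$. $\mathbf{K4}_h=L(\mathbf{H},\mathbf{K}_h,\mathbf{4}_h)$, $\mathbf{KD4}_h=L(\mathbf{H},\mathbf{K}_h,\mathbf{4}_h,\mathbf{D}_h)$,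 $\mathbf{S4}_h=L(\mathbf{H},\mathbf{K}_h,\mathbf{4}_h,\mathbf{T}_h)$, $\mathbf{GL}_h=L(\mathbf{H},\mathbf{K}_h,\mathbf{4}_h,\mathbf{L}_h)$. -}

module Defs where

open import Data.Bool.Base as Bool using (Bool; true; false)
open import Data.List.Base using (List; []; _∷_; _++_)
open import Data.List.Membership.Propositional using (_∈_)
open import Data.List.Relation.Unary.All using (All)
open import Data.Nat.Base using (ℕ; suc; _<_)
open import Data.Sum.Base using (_⊎_)
open import Level using (0ℓ)
open import Relation.Binary.PropositionalEquality.Core using (_≡_)
open import Relation.Unary using (Pred)

infixr 4 _⇒_
infixr 5 _∨_
infixr 6 _∧_
infix  7 ¬_
infix  3 _⊢_

-- Raw modal formulas, without the restriction on box indices.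
data Formula : Set where
  atom        : ℕ → Formula
  ⊥ ⊤         : Formula
  ¬_          : Formula → Formula
  _∧_ _∨_ _⇒_ : Formula → Formula → Formula
  □           : ℕ → Formula → Formula

boxIndices : Formula → List ℕ
boxIndices (atom _) = []
boxIndices ⊥        = []
boxIndices ⊤        = []
boxIndices (¬ A)    = boxIndices A
boxIndices (A ∧ B)  = boxIndices A ++ boxIndices B
boxIndices (A ∨ B)  = boxIndices A ++ boxIndices B
boxIndices (A ⇒ B)  = boxIndices A ++ boxIndices B
boxIndices (□ n A)  = n ∷ boxIndices A

_exceedsBoxesOf_ : ℕ → Formula → Set
n exceedsBoxesOf A = All (_< n) (boxIndices A)

-- The raw formulas that belong to the language 𝓛∞.
data 𝓛∞ : Pred Formula 0ℓ where
  atom : ∀ p → 𝓛∞ (atom p)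
  ⊥    : 𝓛∞ ⊥
  ⊤    : 𝓛∞ ⊤
  ¬_   : ∀ {A} → 𝓛∞ A → 𝓛∞ (¬ A)
  _∧_  : ∀ {A B} → 𝓛∞ A → 𝓛∞ B → 𝓛∞ (A ∧ B)
  _∨_  : ∀ {A B} → 𝓛∞ A → 𝓛∞ B → 𝓛∞ (A ∨ B)
  _⇒_  : ∀ {A B} → 𝓛∞ A → 𝓛∞ B → 𝓛∞ (A ⇒ B)
  □    : ∀ {n A} → n exceedsBoxesOf A → 𝓛∞ A → 𝓛∞ (□ n A)

-- Classical truth value of a formula, where v assigns values to the atoms and
-- w assigns values, independently of v, to the boxed formulas □ n A, which are
-- thus treated as further propositional variables.
eval : (v : ℕ → Bool) (w : ℕ → Formula → Bool) → Formula → Bool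
eval v w (atom p) = v p
eval v w ⊥        = false
eval v w ⊤        = true
eval v w (¬ A)    = Bool.not (eval v w A)
eval v w (A ∧ B)  = eval v w A Bool.∧ eval v w B
eval v w (A ∨ B)  = eval v w A Bool.∨ eval v w B
eval v w (A ⇒ B)  = Bool.not (eval v w A) Bool.∨ eval v w B
eval v w (□ n A)  = w n A

Tautology : Pred Formula 0ℓ
Tautology A = ∀ v w → eval v w A ≡ true

data Scheme : Set where
  H Kₕ 4ₕ Dₕ Lₕ Tₕ : Scheme

data Instance : Scheme → Pred Formula 0ℓ where
  H  : ∀ n A   → Instance H  (□ n A ⇒ □ (suc n) A)
  Kₕ : ∀ n A B → Instance Kₕ (□ n (A ⇒ B) ⇒ (□ n A ⇒ □ n B))
  4ₕ : ∀ n A   → Instance 4ₕ (□ n A ⇒ □ (suc n) (□ n A))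
  Dₕ : ∀ n     → Instance Dₕ (¬ □ n ⊥)
  Lₕ : ∀ n A   → Instance Lₕ (□ (suc n) (□ n A ⇒ A) ⇒ □ n A)
  Tₕ : ∀ n A   → Instance Tₕ (□ n A ⇒ A)

-- X ⊢ A says that A belongs to L(X).  Only tautologies and axiom instances lying
-- in 𝓛∞ are admitted, and both rules preserve 𝓛∞, so every derivable formula is
-- in 𝓛∞.
data _⊢_ (X : List Scheme) : Pred Formula 0ℓ where
  taut  : ∀ {A} → 𝓛∞ A → Tautology A → X ⊢ A
  axiom : ∀ {s A} → s ∈ X → 𝓛∞ A → Instance s A → X ⊢ A
  mp    : ∀ {A B} → X ⊢ A ⇒ B → X ⊢ A → X ⊢ B
  nec   : ∀ {n A} → n exceedsBoxesOf A → X ⊢ A → X ⊢ □ n A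

K4ₕ KD4ₕ S4ₕ GLₕ : List Scheme
K4ₕ  = H ∷ Kₕ ∷ 4ₕ ∷ []
KD4ₕ = H ∷ Kₕ ∷ 4ₕ ∷ Dₕ ∷ []
S4ₕ  = H ∷ Kₕ ∷ 4ₕ ∷ Tₕ ∷ []
GLₕ  = H ∷ Kₕ ∷ 4ₕ ∷ Lₕ ∷ []

StrongDisjunctionProperty : List Scheme → Set
StrongDisjunctionProperty X =
  ∀ n m A B → 𝓛∞ (□ n A) → 𝓛∞ (□ m B) →
  X ⊢ □ n A ∨ □ m B → (X ⊢ A) ⊎ (X ⊢ B)

{-# OPTIONS --safe #-}

-- Let R be the desired conclusion (X ⊢ A) ⊎ (X ⊢ B) and read formulas in the
-- continuation monad with answer type R (Friedman's trick on top of Kuroda's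
-- negative translation), □ n A being read as "A is derivable", Kleene-slash
-- style, together with the meaning of A when Löb's axiom is absent.  Every
-- derivable formula holds in this reading: a tautology does because, with answer
-- type R, the finitely many boxed formulas in it may be assumed decided.  Applied
-- to □ n A ∨ □ m B this yields R.  No decidability of the logic is needed.
module Submission where

open import Data.Bool.Base using (Bool; true; false; not; if_then_else_)
import Data.Bool.Base as Bool
open import Data.Empty using (⊥-elim)
open import Data.List.Base using (List; []; _∷_; _++_)
open import Data.List.Membership.Propositional using (_∈_; _∉_)
open import Data.List.Relation.Unary.All as All using (All; []; _∷_)
open import Data.List.Relation.Unary.All.Properties using (++⁻ˡ; ++⁻ʳ)
open import Data.List.Relation.Unary.Any using (there)
open import Data.Nat.Base using (ℕ)
import Data.Nat.Properties as ℕ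
open import Data.Product.Base using (_×_; _,_; proj₁; proj₂; ∃-syntax; Σ-syntax)
open import Data.Sum.Base as Sum using (_⊎_; inj₁; inj₂; [_,_])
open import Function.Base using (_∘_; id)
open import Function.Bundles using (mk↣)
open import Relation.Binary.Definitions using (DecidableEquality)
open import Relation.Binary.PropositionalEquality using (_≡_; refl; sym; trans; cong; cong₂; subst)
open import Relation.Nullary.Decidable using (Dec; yes; no; does; map′; _×-dec_; via-injection)
open import Defs

-- Formulas are embedded in a type with two constructors so that deciding their
-- equality does not take a quadratic number of cases.
data Tree : Set where
  leaf : Tree
  node : (tag index : ℕ) (l r : Tree) → Tree

_≟ᵀ_ : DecidableEquality Tree
leaf         ≟ᵀ leaf             = yes refl
leaf         ≟ᵀ node _ _ _ _     = no λ ()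
node _ _ _ _ ≟ᵀ leaf             = no λ ()
node t i l r ≟ᵀ node t′ i′ l′ r′ =
  map′ (λ { (refl , refl , refl , refl) → refl })
       (λ { refl → refl , refl , refl , refl })
       ((t ℕ.≟ t′) ×-dec (i ℕ.≟ i′) ×-dec (l ≟ᵀ l′) ×-dec (r ≟ᵀ r′))

toTree : Formula → Tree
toTree (atom p) = node 0 p leaf leaf
toTree ⊥        = node 1 0 leaf leaf
toTree ⊤        = node 2 0 leaf leaf
toTree (¬ A)    = node 3 0 (toTree A) leaf
toTree (A ∧ B)  = node 4 0 (toTree A) (toTree B)
toTree (A ∨ B)  = node 5 0 (toTree A) (toTree B)
toTree (A ⇒ B)  = node 6 0 (toTree A) (toTree B)
toTree (□ n A)  = node 7 n (toTree A) leaf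

fromTree : Tree → Formula
fromTree (node 0 p _ _) = atom p
fromTree (node 1 _ _ _) = ⊥
fromTree (node 3 _ l _) = ¬ fromTree l
fromTree (node 4 _ l r) = fromTree l ∧ fromTree r
fromTree (node 5 _ l r) = fromTree l ∨ fromTree r
fromTree (node 6 _ l r) = fromTree l ⇒ fromTree r
fromTree (node 7 n l _) = □ n (fromTree l)
-- The default also decodes tag 2, so `⊤` needs no clause of its own.
fromTree _              = ⊤

fromTree∘toTree : ∀ A → fromTree (toTree A) ≡ A
fromTree∘toTree (atom p) = refl
fromTree∘toTree ⊥        = refl
fromTree∘toTree ⊤        = refl
fromTree∘toTree (¬ A)    = cong ¬_ (fromTree∘toTree A)
fromTree∘toTree (A ∧ B)  = cong₂ _∧_ (fromTree∘toTree A) (fromTree∘toTree B)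
fromTree∘toTree (A ∨ B)  = cong₂ _∨_ (fromTree∘toTree A) (fromTree∘toTree B)
fromTree∘toTree (A ⇒ B)  = cong₂ _⇒_ (fromTree∘toTree A) (fromTree∘toTree B)
fromTree∘toTree (□ n A)  = cong (□ n) (fromTree∘toTree A)

toTree-injective : ∀ {A B} → toTree A ≡ toTree B → A ≡ B
toTree-injective {A} {B} eq =
  trans (sym (fromTree∘toTree A)) (trans (cong fromTree eq) (fromTree∘toTree B))

_≟_ : DecidableEquality Formula
_≟_ = via-injection (mk↣ toTree-injective) _≟ᵀ_

module Slash (X : List Scheme) (R : Set) where

  Cont : Set → Set
  Cont P = (P → R) → R

  return : ∀ {P} → P → Cont P
  return p k = k p

  _>>=_ : ∀ {P Q : Set} → Cont P → (P → Cont Q) → Cont Q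
  (c >>= f) k = c λ p → f p k

  mutual
    -- Atoms are read as falsity, to match the constantly false valuation in `eval-reflects`. The
    -- index of a box is ignored, which makes `H` immediate.
    ⟦_⟧ : Formula → Set
    ⟦ atom _ ⟧ = R
    ⟦ ⊥ ⟧      = R
    ⟦ ⊤ ⟧      = R → R
    ⟦ ¬ A ⟧    = ⟦ A ⟧ → R
    ⟦ A ∧ B ⟧  = ⟦ A ⟧ × ⟦ B ⟧
    ⟦ A ∨ B ⟧  = ⟦ A ⟧ ⊎ ⟦ B ⟧
    ⟦ A ⇒ B ⟧  = ⟦ A ⟧ → Cont ⟦ B ⟧
    ⟦ □ _ A ⟧  = ⟦□ A ⟧

    -- In the presence of Lₕ the second component could not be justified, while
    -- Dₕ and Tₕ depend on it.
    ⟦□_⟧ : Formula → Set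
    ⟦□ A ⟧ = (X ⊢ A) × (Lₕ ∉ X → Cont ⟦ A ⟧)

  Reflects : Set → Bool → Set
  Reflects P true  = P
  Reflects P false = P → R

  -- Excluded middle under `Cont`: the continuation is first told `false`, and any later proof of
  -- `P` re-enters it with `true`.
  decide : ∀ P → Cont (∃[ b ] Reflects P b)
  decide P k = k (false , λ p → k (true , p))

  -- Boxes inside a body are not collected, since `eval` treats a boxed formula as a variable.
  boxBodies : Formula → List Formula
  boxBodies (atom _) = []
  boxBodies ⊥        = []
  boxBodies ⊤        = []
  boxBodies (¬ A)    = boxBodies A
  boxBodies (A ∧ B)  = boxBodies A ++ boxBodies B
  boxBodies (A ∨ B)  = boxBodies A ++ boxBodies B
  boxBodies (A ⇒ B)  = boxBodies A ++ boxBodies B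
  boxBodies (□ _ A)  = A ∷ []

  decideBoxes : ∀ Bs → Cont (Σ[ w ∈ (Formula → Bool) ] All (λ B → Reflects ⟦□ B ⟧ (w B)) Bs)
  decideBoxes []       = return ((λ _ → false) , [])
  decideBoxes (B ∷ Bs) =
    decide ⟦□ B ⟧ >>= λ (b , rb) →
    decideBoxes Bs >>= λ (w , rs) →
    -- If `B` recurs in `Bs`, its earlier value is overwritten by `b`; `rb` then justifies the new
    -- value there too.
    let w′ = λ C → if does (C ≟ B) then b else w C
        update : ∀ C → Reflects ⟦□ C ⟧ (w C) ⊎ C ≡ B → Reflects ⟦□ C ⟧ (w′ C)
        update C = override (C ≟ B) b (w C) rb
    in return (w′ , update B (inj₂ refl) ∷ All.map (λ {C} r → update C (inj₁ r)) rs)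
    where
    override : ∀ {C} (C≟B : Dec (C ≡ B)) b b′ → Reflects ⟦□ B ⟧ b →
               Reflects ⟦□ C ⟧ b′ ⊎ C ≡ B →
               Reflects ⟦□ C ⟧ (if does C≟B then b else b′)
    override (yes refl) _ _ rb _          = rb
    override (no _)     _ _ _  (inj₁ r)   = r
    override (no C≢B)   _ _ _  (inj₂ C≡B) = ⊥-elim (C≢B C≡B)

  reflects-¬ : ∀ {P} b → Reflects P b → Reflects (P → R) (not b)
  reflects-¬ true  p  = λ ¬p → ¬p p
  reflects-¬ false ¬p = ¬p

  reflects-∧ : ∀ {P Q} b c → Reflects P b → Reflects Q c → Reflects (P × Q) (b Bool.∧ c)
  reflects-∧ true  true  p  q  = p , q
  reflects-∧ true  false _  ¬q = ¬q ∘ proj₂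
  reflects-∧ false _     ¬p _  = ¬p ∘ proj₁

  reflects-∨ : ∀ {P Q} b c → Reflects P b → Reflects Q c → Reflects (P ⊎ Q) (b Bool.∨ c)
  reflects-∨ true  _     p  _  = inj₁ p
  reflects-∨ false true  _  q  = inj₂ q
  reflects-∨ false false ¬p ¬q = [ ¬p , ¬q ]

  reflects-⇒ : ∀ {P Q} b c → Reflects P b → Reflects Q c →
               Reflects (P → Cont Q) (not b Bool.∨ c)
  reflects-⇒ true  true  _  q  = λ _ → return q
  reflects-⇒ true  false p  ¬q = λ f → f p ¬q
  reflects-⇒ false _     ¬p _  = λ p _ → ¬p p

  eval-reflects : ∀ w A → All (λ B → Reflects ⟦□ B ⟧ (w B)) (boxBodies A) →
                  Reflects ⟦ A ⟧ (eval (λ _ → false) (λ _ → w) A)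
  eval-reflects w (atom _) _ = id
  eval-reflects w ⊥        _ = id
  eval-reflects w ⊤        _ = id
  eval-reflects w (¬ A)   rs = reflects-¬ _ (eval-reflects w A rs)
  eval-reflects w (A ∧ B) rs =
    reflects-∧ _ _ (eval-reflects w A (++⁻ˡ _ rs)) (eval-reflects w B (++⁻ʳ (boxBodies A) rs))
  eval-reflects w (A ∨ B) rs =
    reflects-∨ _ _ (eval-reflects w A (++⁻ˡ _ rs)) (eval-reflects w B (++⁻ʳ (boxBodies A) rs))
  eval-reflects w (A ⇒ B) rs =
    reflects-⇒ _ _ (eval-reflects w A (++⁻ˡ _ rs)) (eval-reflects w B (++⁻ʳ (boxBodies A) rs))
  eval-reflects w (□ _ A) (r ∷ []) = r

  tautology-sound : ∀ {A} → Tautology A → Cont ⟦ A ⟧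
  tautology-sound {A} t =
    decideBoxes (boxBodies A) >>= λ (w , rs) →
    return (subst (Reflects ⟦ A ⟧) (t (λ _ → false) (λ _ → w)) (eval-reflects w A rs))

  module _ (Lₕ-excludes : Lₕ ∈ X → Dₕ ∉ X × Tₕ ∉ X) where

    axiom-sound : ∀ {s A} → s ∈ X → 𝓛∞ A → Instance s A → ⟦ A ⟧
    axiom-sound _ _ (H _ _) a = return a
    axiom-sound _ _ (Kₕ _ _ _) (d , f) = return λ (e , g) →
      return (mp d e , λ l → f l >>= λ h → g l >>= h)
    axiom-sound _ (□ p _ ⇒ _) (4ₕ _ _) (d , f) = return (nec p d , λ _ → return (d , f))
    -- As `⟦ ⊥ ⟧` is `R`, the continuation `id` extracts the answer.
    axiom-sound s∈X _ (Dₕ _) (_ , f) = f (λ l → proj₁ (Lₕ-excludes l) s∈X) id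
    -- Löb's rule: necessitating `d`, a derivation of `□ n A ⇒ A`, and applying the axiom derives
    -- `□ n A`; `d` again then derives `A`.
    axiom-sound s∈X 𝓛A@(□ p _ ⇒ _) i@(Lₕ _ _) (d , _) =
      return (mp d (mp (axiom s∈X 𝓛A i) (nec p d)) , λ l∉X → ⊥-elim (l∉X s∈X))
    axiom-sound s∈X _ (Tₕ _ _) (_ , f) = f (λ l → proj₂ (Lₕ-excludes l) s∈X)

    sound : ∀ {A} → X ⊢ A → Cont ⟦ A ⟧
    sound (taut _ t)       = tautology-sound t
    sound (axiom s∈X 𝓛A i) = return (axiom-sound s∈X 𝓛A i)
    sound (mp d e)         = sound d >>= λ f → sound e >>= f
    sound (nec _ d)        = return (d , λ _ → sound d)

strongDisjunctionProperty : ∀ {X} → (Lₕ ∈ X → Dₕ ∉ X × Tₕ ∉ X) → StrongDisjunctionProperty X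
strongDisjunctionProperty {X} Lₕ-excludes n m A B _ _ d =
  -- The final continuation keeps the derivation stored in whichever box holds.
  Slash.sound X ((X ⊢ A) ⊎ (X ⊢ B)) Lₕ-excludes d (Sum.map proj₁ proj₁)

theorem3p15 : StrongDisjunctionProperty K4ₕ × StrongDisjunctionProperty KD4ₕ × StrongDisjunctionProperty S4ₕ × StrongDisjunctionProperty GLₕ
theorem3p15 =
    strongDisjunctionProperty (λ { (there (there (there ()))) })
  , strongDisjunctionProperty (λ { (there (there (there (there ())))) })
  , strongDisjunctionProperty (λ { (there (there (there (there ())))) })
  , strongDisjunctionProperty (λ _ → (λ { (there (there (there (there ())))) })
                                   , (λ { (there (there (there (there ())))) }))
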